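{- Let $k$ be a positive integer and let $G=(V,E)$ be a $k$-vertex-critical digraph with $|V|\leq 2k-2$. Then the complement $\overline G$ is disconnected.
   Context: A digraph $G=(V,E)$ is finite, with $E\subseteq \{(u,v): u,v\in V, u\neq v\}$ (loopless, at most one arc in each direction between two vertices). A colouring of $G$ is a partition of $V$ into parts (colour classes) each of which induces an acyclic subdigraph (contains no directed cycle; a pair of opposite arcs $(u,v),(v,u)$ counts as a directed cycle of length 2). The dichromatic number $\chi(G)$ is the minimum number of colour classes in a colouring of $G$. $G$ is $k$-vertex-critical if $\chi(G)=k$ and every proper induced subdigraph $G'$ of $G$ satisfies $\chi(G')<k$. The complement $\overline G$ is the digraph on $V$ in which, for distinct $u,v$, $(u,v)$ is an arc iff $(u,v)\notin E$. $\overline G$ is disconnected if its underlying undirected graph is disconnected. -}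

module Defs where

open import Data.Nat using (ℕ; suc; _≤_; _∸_; _*_)
open import Data.Fin using (Fin)
open import Data.Bool using (Bool; true; false; not; _∧_)
open import Relation.Nullary.Decidable using (⌊_⌋)
import Data.Fin
open import Data.List using (List; []; _∷_)
open import Data.Product using (Σ; ∃; _×_; _,_)
open import Relation.Binary.PropositionalEquality using (_≡_)
open import Relation.Nullary using (¬_)

record Digraph (n : ℕ) : Set where
  field
    arc      : Fin n → Fin n → Bool
    loopless : ∀ v → arc v v ≡ false
open Digraph public

VSet : ℕ → Set
VSet n = Fin n → Bool

_∈ᵥ_ : ∀ {n} → Fin n → VSet n → Set
v ∈ᵥ S = S v ≡ true

data Walk {n : ℕ} (G : Digraph n) (S : VSet n) : Fin n → Fin n → Set where
  one  : ∀ {u v} → u ∈ᵥ S → v ∈ᵥ S → arc G u v ≡ true → Walk G S u v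
  step : ∀ {u v w} → u ∈ᵥ S → arc G u v ≡ true → Walk G S v w → Walk G S u w

-- S induces a subdigraph with a directed cycle (closed directed walk of
-- positive length inside S; a 2-cycle (u,v),(v,u) is included).
HasDirectedCycle : ∀ {n} → Digraph n → VSet n → Set
HasDirectedCycle G S = ∃ λ v → Walk G S v v

Acyclic : ∀ {n} → Digraph n → VSet n → Set
Acyclic G S = ¬ HasDirectedCycle G S

Class : ∀ {n c} → VSet n → (Fin n → Fin c) → Fin c → VSet n
Class U f i v = U v ∧ ⌊ f v Data.Fin.≟ i ⌋

ColourableOn : ∀ {n} → Digraph n → VSet n → ℕ → Set
ColourableOn {n} G U c =
  Σ (Fin n → Fin c) λ f → ∀ (i : Fin c) → Acyclic G (Class U f i)

Colourable : ∀ {n} → Digraph n → ℕ → Set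
Colourable G c = ColourableOn G (λ _ → true) c

DichromaticNumberIs : ∀ {n} → Digraph n → ℕ → Set
DichromaticNumberIs G k = Colourable G k × ¬ Colourable G (k ∸ 1)

VertexCritical : ∀ {n} → Digraph n → ℕ → Set
VertexCritical {n} G k =
  DichromaticNumberIs G k ×
  (∀ (U : VSet n) → (∃ λ v → U v ≡ false) → ColourableOn G U (k ∸ 1))

complement : ∀ {n} → Digraph n → Fin n → Fin n → Bool
complement G u v = not (arc G u v)

data CAdj {n : ℕ} (G : Digraph n) (u v : Fin n) : Set where
  fwd : ¬ u ≡ v → complement G u v ≡ true → CAdj G u v
  bwd : ¬ u ≡ v → complement G v u ≡ true → CAdj G u v

data CReach {n : ℕ} (G : Digraph n) : Fin n → Fin n → Set where
  here  : ∀ {u} → CReach G u u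
  there : ∀ {u v w} → CAdj G u v → CReach G v w → CReach G u w

ComplementDisconnected : ∀ {n} → Digraph n → Set
ComplementDisconnected G = ∃ λ u → ∃ λ v → ¬ CReach G u v

{-# OPTIONS --safe #-}

-- Call a colour class of size one a singleton, and let f be a k-colouring of G
-- with as few singletons as possible.  As |V| ≤ 2k-2, it has two of them, {x}
-- and {z}.  Let a be a neighbour of x in the complement, and let q be a
-- k-colouring in which {a} is a class (it exists by criticality).  Grow
-- alternating paths from x: if u has been freed (made a singleton by
-- recolouring f) and p lies in the q-class of u, then p may join u.
-- This saves a colour if {p} was a class, and a singleton if the class of p
-- had at least three vertices; otherwise it frees the partner of p.  If a is
-- never freed, the explored region is a union of f-classes and a union of
-- q-classes, so f inside with q outside, and q inside with f outside, are
-- colourings with 2k colours in total.  Each needs at least k, so the former has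
-- exactly k, and merging {x} with {a} saves one.  Hence a can be freed while {z}
-- stays a singleton.  Repeating this along a path from x to z in the
-- complement, two adjacent singletons appear, and merging them saves a colour.

module Submission where

open import Defs
open import Data.Nat using (ℕ; zero; suc; _+_; _*_; _∸_; _≤_; _<_; s≤s; s≤s⁻¹; _≤?_)
open import Data.Nat.Properties using (≤-refl; ≤-trans; ≤-reflexive; <-≤-trans; ≰⇒>; +-suc; +-identityʳ; +-mono-≤; +-monoʳ-<; <-irrefl; <⇒≱; ≤-<-trans; +-comm)
open import Data.Nat.Solver using (module +-*-Solver)
open import Data.Nat.Induction using (<-rec)
open import Data.Bool using (true; false; not)
open import Data.Bool.Properties using () renaming (_≟_ to _≟ᵇ_)
open import Data.Fin using (Fin; zero; suc; _≟_; inject≤; punchIn; splitAt; join)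
open import Data.Fin.Properties using (any?; all?; inject≤-injective; injective⇒≤; join-splitAt; punchIn-injective; punchInᵢ≢i; suc-injective)
open import Data.List using (List; []; _∷_; length; filter; allFin; map; _++_; lookup)
open import Data.List.Properties using (length-map; length-++; length-tabulate; filter-notAll)
open import Data.List.Relation.Unary.Any using (here; there; index)
open import Data.List.Relation.Unary.Any.Properties using (lookup-index)
open import Data.List.Membership.Propositional using (_∈_; _∉_; lose)
open import Data.List.Membership.Propositional.Properties using (∈-map⁺; ∈-++⁺ˡ; ∈-++⁺ʳ; ∈-filter⁺; ∈-filter⁻; ∈-allFin)
import Data.List.Membership.DecPropositional as DecMembership
open import Data.Product using (∃; _×_; _,_; proj₁; proj₂)
open import Data.Sum using (_⊎_; inj₁; inj₂; swap)
open import Data.Empty using (⊥-elim)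
open import Function using (_∘_)
open import Level using (0ℓ)
open import Relation.Nullary using (¬_; Dec; yes; no; ¬?; contradiction)
open import Relation.Nullary.Decidable using (_×-dec_; _→-dec_; _⊎-dec_; map′; decidable-stable; ⌊_⌋)
open import Relation.Unary using (Pred; Decidable)
open import Relation.Binary.PropositionalEquality using (_≡_; _≢_; refl; sym; trans; cong; subst; cong₂)

-- Deleting and counting in lists

_∈?_ : ∀ {m} (i : Fin m) (L : List (Fin m)) → Dec (i ∈ L)
_∈?_ = DecMembership._∈?_ _≟_

-- Abstract so that L can be inferred from L ∖ i.
abstract

  _∖_ : ∀ {m} → List (Fin m) → Fin m → List (Fin m)
  L ∖ i = filter (λ j → ¬? (j ≟ i)) L

  length-∖ : ∀ {m} {i : Fin m} {L} → i ∈ L → length (L ∖ i) < length L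
  length-∖ i∈L = filter-notAll (λ j → ¬? (j ≟ _)) _ (lose i∈L (λ j≢i → j≢i refl))

  ∈-∖⁺ : ∀ {m} {i j : Fin m} {L} → j ∈ L → j ≢ i → j ∈ L ∖ i
  ∈-∖⁺ = ∈-filter⁺ (λ j → ¬? (j ≟ _))

  ∈-∖⁻ : ∀ {m} {i j : Fin m} {L} → j ∈ L ∖ i → j ∈ L × j ≢ i
  ∈-∖⁻ = ∈-filter⁻ (λ j → ¬? (j ≟ _))

length-filter-¬ : ∀ {A : Set} {P : Pred A 0ℓ} (P? : Decidable P) (L : List A) →
  length (filter P? L) + length (filter (¬? ∘ P?) L) ≡ length L
length-filter-¬ P? [] = refl
length-filter-¬ P? (x ∷ L) with P? x
... | yes _ = cong suc (length-filter-¬ P? L)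
... | no  _ = trans (+-suc _ _) (cong suc (length-filter-¬ P? L))

length-allFin : ∀ m → length (allFin m) ≡ m
length-allFin m = length-tabulate _

-- Recolourings and singleton classes

module _ {n : ℕ} where

  recolour : {C : Set} → (Fin n → C) → Fin n → C → Fin n → C
  recolour g p c v with v ≟ p
  ... | yes _ = c
  ... | no  _ = g v

  recolour-at : {C : Set} (g : Fin n → C) (p : Fin n) (c : C) → recolour g p c p ≡ c
  recolour-at g p c with p ≟ p
  ... | yes _  = refl
  ... | no p≢p = contradiction refl p≢p

  recolour-off : {C : Set} (g : Fin n → C) {p v : Fin n} (c : C) → v ≢ p → recolour g p c v ≡ g v
  recolour-off g {p} {v} c v≢p with v ≟ p
  ... | yes v≡p = contradiction v≡p v≢p
  ... | no _    = refl

  Singleton : {C : Set} → (Fin n → C) → Fin n → Set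
  Singleton g v = ∀ w → g w ≡ g v → w ≡ v

  singleton? : ∀ {m} (g : Fin n → Fin m) → Decidable (Singleton g)
  singleton? g v = all? (λ w → (g w ≟ g v) →-dec (w ≟ v))

  ¬singleton : ∀ {m} (g : Fin n → Fin m) {v} → ¬ Singleton g v → ∃ λ w → g w ≡ g v × w ≢ v
  ¬singleton g {v} ¬s with any? (λ w → (g w ≟ g v) ×-dec ¬? (w ≟ v))
  ... | yes found = found
  ... | no none   = contradiction (λ w gw≡gv → decidable-stable (w ≟ v) (λ w≢v → none (w , gw≡gv , w≢v))) ¬s

  -- The list need only cover the singletons, so a bound is updated by deleting and adding entries,
  -- without an exact count.
  AtMostSingletons : {C : Set} → (Fin n → C) → ℕ → Set
  AtMostSingletons g ℓ = ∃ λ L → length L ≤ ℓ × (∀ v → Singleton g v → v ∈ L)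

  -- Disjoint representatives: one vertex of every class, and a second one of every class but that of c.
  two-per-class : ∀ {k} (f : Fin n → Fin (suc k)) (s : Fin (suc k) → Fin n) → (∀ i → f (s i) ≡ i) →
    (c : Fin (suc k)) → (∀ i → i ≢ c → ¬ Singleton f (s i)) → suc k + k ≤ n
  two-per-class {k} f s fs≡ c ¬single = injective⇒≤ {f = rep ∘ splitAt (suc k)} λ {i} {j} eq →
    trans (sym (join-splitAt (suc k) k i))
      (trans (cong (join (suc k) k) (rep-injective (splitAt (suc k) i) (splitAt (suc k) j) eq)) (join-splitAt (suc k) k j))
    where
    second : (i : Fin k) → ∃ λ w → f w ≡ f (s (punchIn c i)) × w ≢ s (punchIn c i)
    second i = ¬singleton f (¬single (punchIn c i) (punchInᵢ≢i c i))

    f-second : ∀ i → f (proj₁ (second i)) ≡ punchIn c i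
    f-second i = trans (proj₁ (proj₂ (second i))) (fs≡ _)

    rep : Fin (suc k) ⊎ Fin k → Fin n
    rep (inj₁ i) = s i
    rep (inj₂ i) = proj₁ (second i)

    first≢second : ∀ i j → s i ≢ proj₁ (second j)
    first≢second i j eq = proj₂ (proj₂ (second j))
      (trans (sym eq) (cong s (trans (sym (fs≡ i)) (trans (cong f eq) (f-second j)))))

    rep-injective : ∀ a b → rep a ≡ rep b → a ≡ b
    rep-injective (inj₁ i) (inj₁ j) eq = cong inj₁ (trans (sym (fs≡ i)) (trans (cong f eq) (fs≡ j)))
    rep-injective (inj₁ i) (inj₂ j) eq = contradiction eq (first≢second i j)
    rep-injective (inj₂ i) (inj₁ j) eq = contradiction (sym eq) (first≢second j i)
    rep-injective (inj₂ i) (inj₂ j) eq = cong inj₂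
      (punchIn-injective c i j (trans (sym (f-second i)) (trans (cong f eq) (f-second j))))

-- Acyclic sets and proper colourings

module _ {n : ℕ} (G : Digraph n) where

  -- `P` is an arbitrary predicate and `S` ranges over its Boolean subsets, so passing to a smaller
  -- `P` is immediate.
  Face : (Fin n → Set) → Set
  Face P = ∀ S → (∀ v → v ∈ᵥ S → P v) → Acyclic G S

  Proper : {C : Set} → (Fin n → C) → Set
  Proper g = ∀ c → Face (λ v → g v ≡ c)

  start∈ : ∀ {S u v} → Walk G S u v → u ∈ᵥ S
  start∈ (one u∈S _ _)  = u∈S
  start∈ (step u∈S _ _) = u∈S

  walk-mono : ∀ {S S′ u v} → (∀ w → w ∈ᵥ S → w ∈ᵥ S′) → Walk G S u v → Walk G S′ u v
  walk-mono S⊆ (one u∈ v∈ e)  = one (S⊆ _ u∈) (S⊆ _ v∈) e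
  walk-mono S⊆ (step u∈ e w)  = step (S⊆ _ u∈) e (walk-mono S⊆ w)

  first-arc : ∀ {S u v} → Walk G S u v → ∃ λ w → w ∈ᵥ S × arc G u w ≡ true
  first-arc (one _ v∈ e)  = _ , v∈ , e
  first-arc (step _ e w)  = _ , start∈ w , e

  no-loop : ∀ {v} → arc G v v ≢ true
  no-loop {v} e with trans (sym e) (loopless G v)
  ... | ()

  face-vertex : ∀ a → Face (_≡ a)
  face-vertex a S S⊆ (v , w) with first-arc w
  ... | v′ , v′∈S , e with S⊆ v (start∈ w) | S⊆ v′ v′∈S
  ... | refl | refl = no-loop e

  -- A walk inside the pair cannot leave `u`, so a cycle would have to be a loop at `v`.
  face-nonarc : ∀ {u v} → arc G u v ≡ false → Face (λ w → w ≡ u ⊎ w ≡ v)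
  face-nonarc {u} {v} uv∉E S S⊆ (c , w) = closed (S⊆ c (start∈ w)) w
    where
    no-walk-from-u : ∀ {y} → ¬ Walk G S u y
    no-walk-from-u w′ with first-arc w′
    ... | t , t∈S , e with S⊆ t t∈S
    ... | inj₁ refl = no-loop e
    ... | inj₂ refl = contradiction (trans (sym e) uv∉E) (λ ())

    closed : ∀ {c} → c ≡ u ⊎ c ≡ v → ¬ Walk G S c c
    closed (inj₁ refl) w′ = no-walk-from-u w′
    closed (inj₂ refl) (one _ _ e) = no-loop e
    closed (inj₂ refl) (step _ e w′) with S⊆ _ (start∈ w′)
    ... | inj₁ refl = no-walk-from-u w′
    ... | inj₂ refl = no-loop e

  not-true : ∀ {b} → not b ≡ true → b ≡ false
  not-true {false} _ = refl

  face-CAdj : ∀ {u v} → CAdj G u v → Face (λ w → w ≡ u ⊎ w ≡ v)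
  face-CAdj (fwd _ e) = face-nonarc (not-true e)
  face-CAdj (bwd _ e) S S⊆ = face-nonarc (not-true e) S (λ w w∈ → swap (S⊆ w w∈))

  class⁺ : ∀ {c} {U : VSet n} {f : Fin n → Fin c} {i v} → v ∈ᵥ U → f v ≡ i → v ∈ᵥ Class U f i
  class⁺ {U = U} {f} {i} {v} v∈U fv≡i rewrite v∈U with f v ≟ i
  ... | yes _    = refl
  ... | no fv≢i = contradiction fv≡i fv≢i

  class⁻ : ∀ {c} {U : VSet n} {f : Fin n → Fin c} {i v} → v ∈ᵥ Class U f i → f v ≡ i
  class⁻ {U = U} {f} {i} {v} v∈ with U v | f v ≟ i
  ... | true  | yes fv≡i = fv≡i
  ... | true  | no _     = contradiction v∈ (λ ())
  ... | false | _        = contradiction v∈ (λ ())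

  face-class : ∀ {c} {U : VSet n} {f : Fin n → Fin c} {i} → Acyclic G (Class U f i) →
    Face (λ v → v ∈ᵥ U × f v ≡ i)
  face-class {U = U} {f} acyc S S⊆ (v , w) =
    acyc (v , walk-mono (λ t t∈S → class⁺ {U = U} {f} (proj₁ (S⊆ t t∈S)) (proj₂ (S⊆ t t∈S))) w)

  -- Positions in `L` serve as colours; repetitions do no harm, as a position determines its entry.
  proper-listed⇒colourable : ∀ {C : Set} {m} (g : Fin n → C) → Proper g →
    (L : List C) → (∀ v → g v ∈ L) → length L ≤ m → Colourable G m
  proper-listed⇒colourable {m = m} g proper L g∈L len = colour , acyclic
    where
    colour : Fin n → Fin m
    colour v = inject≤ (index (g∈L v)) len

    colour⇒g : ∀ u v → colour u ≡ colour v → g u ≡ g v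
    colour⇒g u v eq = trans (lookup-index (g∈L u))
      (trans (cong (lookup L) (inject≤-injective len len _ _ eq)) (sym (lookup-index (g∈L v))))

    acyclic : ∀ i → Acyclic G (Class (λ _ → true) colour i)
    acyclic i (v , w) = proper (g v) _
      (λ u u∈ → colour⇒g u v (trans (class⁻ {U = λ _ → true} {colour} u∈) (sym (class⁻ {U = λ _ → true} {colour} (start∈ w)))))
      (v , w)

  -- Only the class of `u` can grow, and it becomes `u` together with `p`; every other class can
  -- only shrink.
  proper-recolour : ∀ {m} {g : Fin n → Fin m} {u p} → Proper g → Singleton g u →
    Face (λ w → w ≡ u ⊎ w ≡ p) → Proper (recolour g p (g u))
  proper-recolour {g = g} {u} {p} proper u-single face c S S⊆ with c ≟ g u
  ... | yes refl = face S λ v v∈S → case v (S⊆ v v∈S)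
    where
    case : ∀ v → recolour g p (g u) v ≡ g u → v ≡ u ⊎ v ≡ p
    case v eq with v ≟ p
    ... | yes v≡p = inj₂ v≡p
    ... | no _    = inj₁ (u-single v eq)
  ... | no c≢gu = proper c S λ v v∈S → case v (S⊆ v v∈S)
    where
    case : ∀ v → recolour g p (g u) v ≡ c → g v ≡ c
    case v eq with v ≟ p
    ... | yes _ = contradiction (sym eq) c≢gu
    ... | no _  = eq

  -- Deciding reachability in the complement

  CAdj? : ∀ u v → Dec (CAdj G u v)
  CAdj? u v = map′
    (λ { (u≢v , inj₁ e) → fwd u≢v e ; (u≢v , inj₂ e) → bwd u≢v e })
    (λ { (fwd u≢v e) → u≢v , inj₁ e ; (bwd u≢v e) → u≢v , inj₂ e })
    (¬? (u ≟ v) ×-dec ((complement G u v ≟ᵇ true) ⊎-dec (complement G v u ≟ᵇ true)))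

  reach-snoc : ∀ {u v w} → CReach G u v → CAdj G v w → CReach G u w
  reach-snoc here e        = there e here
  reach-snoc (there d r) e = there d (reach-snoc r e)

  reach-closed : ∀ {P : Fin n → Set} → (∀ {v w} → P v → CAdj G v w → P w) →
    ∀ {u v} → CReach G u v → P u → P v
  reach-closed closed here        Pu = Pu
  reach-closed closed (there e r) Pu = reach-closed closed r (closed Pu e)

  -- U lists the vertices not reached so far.
  explore : ∀ u m (U : List (Fin n)) → length U ≤ m → u ∉ U → (∀ v → v ∉ U → CReach G u v) →
    ∀ v → Dec (CReach G u v)
  explore u m U len u∉U reached v
    with any? (λ w → ¬? (w ∈? U) ×-dec any? (λ p → (p ∈? U) ×-dec CAdj? w p))
  explore u zero [] len u∉U reached v | yes (w , w∉U , p , () , adj)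
  explore u (suc m) U len u∉U reached v | yes (w , w∉U , p , p∈U , adj) =
    explore u m (U ∖ p) (s≤s⁻¹ (<-≤-trans (length-∖ p∈U) len)) (u∉U ∘ proj₁ ∘ ∈-∖⁻) reached′ v
    where
    reached′ : ∀ t → t ∉ U ∖ p → CReach G u t
    reached′ t t∉ with t ≟ p | t ∈? U
    ... | yes refl | _       = reach-snoc (reached w w∉U) adj
    ... | no t≢p   | yes t∈U = contradiction (∈-∖⁺ t∈U t≢p) t∉
    ... | no _     | no t∉U  = reached t t∉U
  explore u m U len u∉U reached v | no closed with v ∈? U
  ... | no v∉U  = yes (reached v v∉U)
  -- No adjacency enters `U`, so everything reachable from `u` stays outside it.
  ... | yes v∈U = no λ r → reach-closed
    (λ {w} {p} w∉U adj p∈U → closed (w , w∉U , p , p∈U , adj)) r u∉U v∈U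

  CReach? : ∀ u v → Dec (CReach G u v)
  CReach? u = explore u _ (allFin n ∖ u) ≤-refl (λ u∈ → proj₂ (∈-∖⁻ u∈) refl) reached
    where
    reached : ∀ v → v ∉ allFin n ∖ u → CReach G u v
    reached v v∉ with v ≟ u
    ... | yes refl = here
    ... | no v≢u   = contradiction (∈-∖⁺ (∈-allFin v) v≢u) v∉

  -- Digraphs that `k` colours do not suffice for

  module _ {k : ℕ} (¬colourable : ¬ Colourable G k) where

    too-few : ∀ {C : Set} (g : Fin n → C) → Proper g → (L : List C) → (∀ v → g v ∈ L) → k < length L
    too-few g proper L g∈L with length L ≤? k
    ... | yes len = contradiction (proper-listed⇒colourable g proper L g∈L len) ¬colourable
    ... | no ¬len = ≰⇒> ¬len

    -- Otherwise the remaining `k` colours would suffice.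
    colour-used : (f : Fin n → Fin (suc k)) → Proper f → ∀ i → ¬ (∀ v → f v ≢ i)
    colour-used f proper i unused = <⇒≱ (too-few f proper (allFin (suc k) ∖ i) (λ v → ∈-∖⁺ (∈-allFin _) (unused v)))
      (s≤s⁻¹ (<-≤-trans (length-∖ (∈-allFin i)) (≤-reflexive (length-allFin (suc k)))))

    no-merge : ∀ {f : Fin n → Fin (suc k)} {u p} → Proper f → Singleton f u → Singleton f p → u ≢ p →
      ¬ Face (λ w → w ≡ u ⊎ w ≡ p)
    no-merge {f} {u} {p} proper u-single p-single u≢p face =
      colour-used _ (proper-recolour proper u-single face) (f p) unused
      where
      unused : ∀ v → recolour f p (f u) v ≢ f p
      unused v eq with v ≟ p
      ... | yes _   = u≢p (p-single u eq)
      ... | no v≢p = v≢p (p-single v eq)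

    two-singletons : (f : Fin n → Fin (suc k)) → Proper f → n < suc k + k →
      ∃ λ x → ∃ λ z → x ≢ z × Singleton f x × Singleton f z
    two-singletons f proper n< with any? (λ x → any? (λ z → ¬? (x ≟ z) ×-dec singleton? f x ×-dec singleton? f z))
    ... | yes found = found
    ... | no none   = contradiction (two-per-class f s fs≡ (proj₁ exception) (proj₂ exception)) (<⇒≱ n<)
      where
      section : ∀ i → ∃ λ v → f v ≡ i
      section i with any? (λ v → f v ≟ i)
      ... | yes found = found
      ... | no unused = ⊥-elim (colour-used f proper i (λ v eq → unused (v , eq)))

      s : Fin (suc k) → Fin n
      s = proj₁ ∘ section

      fs≡ : ∀ i → f (s i) ≡ i
      fs≡ = proj₂ ∘ section

      exception : ∃ λ c → ∀ i → i ≢ c → ¬ Singleton f (s i)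
      exception with any? (singleton? f)
      ... | yes (x , x-single) = f x , λ i i≢fx si-single →
              none (x , s i , (λ x≡si → i≢fx (trans (sym (fs≡ i)) (sym (cong f x≡si)))) , x-single , si-single)
      -- With no singleton at all, any colour may be the exception; `zero` is a default.
      ... | no no-single = zero , λ i _ si-single → no-single (s i , si-single)

    -- The vertices v with f v ∉ U form a union of f-classes and, by hypothesis, of q-classes.
    no-swap : (f q : Fin n → Fin (suc k)) → Proper f → Proper q → (U : List (Fin (suc k))) →
      (∀ v w → f w ∉ U → q v ≡ q w → f v ∉ U) →
      ∀ {x a} → Singleton f x → f x ∉ U → Singleton q a → f a ∈ U →
      ¬ Face (λ w → w ≡ x ⊎ w ≡ a)
    no-swap f q f-proper q-proper U saturated {x} {a} x-single fx∉U a-single fa∈U face =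
      <-irrefl refl total
      where
      K : ℕ
      K = suc k

      inside? : Decidable (λ i → ∃ λ w → f w ∉ U × q w ≡ i)
      inside? i = any? (λ w → ¬? (f w ∈? U) ×-dec (q w ≟ i))

      f-out f-in q-in q-out : List (Fin K)
      f-out = filter (_∈? U) (allFin K)
      f-in  = filter (λ i → ¬? (i ∈? U)) (allFin K)
      q-in  = filter inside? (allFin K)
      q-out = filter (¬? ∘ inside?) (allFin K)

      outside : ∀ {v} → f v ∈ U → ¬ ∃ λ w → f w ∉ U × q w ≡ q v
      outside {v} fv∈U (w , fw∉U , qw≡qv) = saturated v w fw∉U (sym qw≡qv) fv∈U

      g₁ : Fin n → Fin K ⊎ Fin K
      g₁ v with v ≟ a | f v ∈? U
      ... | yes _ | _     = inj₁ (f x)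
      ... | no _  | no _  = inj₁ (f v)
      ... | no _  | yes _ = inj₂ (q v)

      g₁-inj₁ : ∀ {c} v → g₁ v ≡ inj₁ c → (v ≡ a × f x ≡ c) ⊎ (f v ≡ c)
      g₁-inj₁ v eq with v ≟ a | f v ∈? U
      g₁-inj₁ v refl | yes v≡a | _    = inj₁ (v≡a , refl)
      g₁-inj₁ v refl | no _    | no _ = inj₂ refl
      g₁-inj₁ v ()   | no _    | yes _

      g₁-inj₂ : ∀ {c} v → g₁ v ≡ inj₂ c → q v ≡ c
      g₁-inj₂ v eq with v ≟ a | f v ∈? U
      g₁-inj₂ v ()   | yes _ | _
      g₁-inj₂ v ()   | no _  | no _
      g₁-inj₂ v refl | no _  | yes _ = refl

      g₁-proper : Proper g₁
      g₁-proper (inj₂ c) S S⊆ = q-proper c S (λ v v∈S → g₁-inj₂ v (S⊆ v v∈S))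
      g₁-proper (inj₁ c) S S⊆ with c ≟ f x
      ... | yes refl = face S λ v v∈S → merged v (g₁-inj₁ v (S⊆ v v∈S))
        where
        merged : ∀ v → (v ≡ a × f x ≡ f x) ⊎ (f v ≡ f x) → v ≡ x ⊎ v ≡ a
        merged v (inj₁ (v≡a , _)) = inj₂ v≡a
        merged v (inj₂ fv≡fx)     = inj₁ (x-single v fv≡fx)
      ... | no c≢fx = f-proper c S λ v v∈S → unmerged v (g₁-inj₁ v (S⊆ v v∈S))
        where
        unmerged : ∀ v → (v ≡ a × f x ≡ c) ⊎ (f v ≡ c) → f v ≡ c
        unmerged v (inj₁ (_ , fx≡c)) = contradiction (sym fx≡c) c≢fx
        unmerged v (inj₂ fv≡c)       = fv≡c

      L₁ : List (Fin K ⊎ Fin K)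
      L₁ = map inj₁ f-in ++ map inj₂ (q-out ∖ q a)

      g₁∈L₁ : ∀ v → g₁ v ∈ L₁
      g₁∈L₁ v with v ≟ a | f v ∈? U
      ... | yes _  | _        = ∈-++⁺ˡ {xs = map inj₁ f-in} (∈-map⁺ inj₁ (∈-filter⁺ (λ i → ¬? (i ∈? U)) (∈-allFin _) fx∉U))
      ... | no _   | no fv∉U  = ∈-++⁺ˡ {xs = map inj₁ f-in} (∈-map⁺ inj₁ (∈-filter⁺ (λ i → ¬? (i ∈? U)) (∈-allFin _) fv∉U))
      ... | no v≢a | yes fv∈U = ∈-++⁺ʳ (map inj₁ f-in) (∈-map⁺ inj₂
              (∈-∖⁺ (∈-filter⁺ (¬? ∘ inside?) (∈-allFin _) (outside fv∈U)) (v≢a ∘ a-single v)))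

      -- The opposite exchange: `f` on the unexplored region, `q` on the explored one.
      g₂ : Fin n → Fin K ⊎ Fin K
      g₂ v with f v ∈? U
      ... | yes _ = inj₁ (f v)
      ... | no _  = inj₂ (q v)

      g₂-inj₁ : ∀ {c} v → g₂ v ≡ inj₁ c → f v ≡ c
      g₂-inj₁ v eq with f v ∈? U
      g₂-inj₁ v refl | yes _ = refl
      g₂-inj₁ v ()   | no _

      g₂-inj₂ : ∀ {c} v → g₂ v ≡ inj₂ c → q v ≡ c
      g₂-inj₂ v eq with f v ∈? U
      g₂-inj₂ v ()   | yes _
      g₂-inj₂ v refl | no _ = refl

      g₂-proper : Proper g₂
      g₂-proper (inj₁ c) S S⊆ = f-proper c S (λ v v∈S → g₂-inj₁ v (S⊆ v v∈S))
      g₂-proper (inj₂ c) S S⊆ = q-proper c S (λ v v∈S → g₂-inj₂ v (S⊆ v v∈S))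

      L₂ : List (Fin K ⊎ Fin K)
      L₂ = map inj₁ f-out ++ map inj₂ q-in

      g₂∈L₂ : ∀ v → g₂ v ∈ L₂
      g₂∈L₂ v with f v ∈? U
      ... | yes fv∈U = ∈-++⁺ˡ {xs = map inj₁ f-out} (∈-map⁺ inj₁ (∈-filter⁺ (_∈? U) (∈-allFin _) fv∈U))
      ... | no fv∉U  = ∈-++⁺ʳ (map inj₁ f-out) (∈-map⁺ inj₂ (∈-filter⁺ inside? (∈-allFin _) (v , fv∉U , refl)))

      length-sum : (A B : List (Fin K)) → length (map inj₁ A ++ map inj₂ B) ≡ length A + length B
      length-sum A B = trans (length-++ (map inj₁ A)) (cong₂ _+_ (length-map inj₁ A) (length-map inj₂ B))

      K≤₁ : K ≤ length f-in + length (q-out ∖ q a)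
      K≤₁ = ≤-trans (too-few g₁ g₁-proper L₁ g₁∈L₁) (≤-reflexive (length-sum f-in (q-out ∖ q a)))

      K≤₂ : K ≤ length f-out + length q-in
      K≤₂ = ≤-trans (too-few g₂ g₂-proper L₂ g₂∈L₂) (≤-reflexive (length-sum f-out q-in))

      regroup : ∀ i j b c → (j + b) + (i + c) ≡ (i + j) + (c + b)
      regroup = solve 4 (λ i j b c → (j :+ b) :+ (i :+ c) := (i :+ j) :+ (c :+ b)) refl
        where open +-*-Solver

      -- Together `L₁` and `L₂` list each colour of `f` and of `q` at most once and spare `q a`, so
      -- they have fewer than `K + K` entries, while each needs at least `K`.
      total : K + K < K + K
      total = <-≤-trans
        (≤-<-trans (+-mono-≤ K≤₂ K≤₁)
          (+-monoʳ-< (length f-out + length q-in) (+-monoʳ-< (length f-in)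
            (length-∖ (∈-filter⁺ (¬? ∘ inside?) (∈-allFin _) (outside fa∈U))))))
        (≤-reflexive (trans (regroup (length f-in) (length f-out) (length q-in) (length q-out))
          (cong₂ _+_ (trans (+-comm (length f-in) (length f-out))
                       (trans (length-filter-¬ (_∈? U) (allFin K)) (length-allFin K)))
                     (trans (+-comm (length q-out) (length q-in))
                       (trans (length-filter-¬ inside? (allFin K)) (length-allFin K))))))

    -- Freeing a neighbour along alternating paths

    module _ (f q : Fin n → Fin (suc k)) (f-proper : Proper f) (q-proper : Proper q)
             {x a z : Fin n} (x-single : Singleton f x) (z-single : Singleton f z) (x≢z : x ≢ z)
             (a-single : Singleton q a) (xa-face : Face (λ w → w ≡ x ⊎ w ≡ a))
             (ℓ : ℕ) (f-few : AtMostSingletons f ℓ)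
             (no-fewer : ∀ {ℓ′} → ℓ′ < ℓ → (g : Fin n → Fin (suc k)) → Proper g → ¬ AtMostSingletons g ℓ′)
             where

      -- U lists the f-colours whose classes have not been explored, and g is a recolouring of f
      -- on the explored vertices, within the explored colours, that makes u a singleton.
      record Freed (U : List (Fin (suc k))) (u : Fin n) : Set where
        field
          g        : Fin n → Fin (suc k)
          proper   : Proper g
          few      : AtMostSingletons g ℓ
          single   : Singleton g u
          explored : f u ∉ U
          agree    : ∀ v → f v ∈ U → g v ≡ f v
          separate : ∀ v → f v ∉ U → g v ∉ U

        -- By `separate`, an explored vertex cannot take an unexplored colour, so unexplored classes
        -- survive intact in `g`.
        class-kept : ∀ {v w} → f w ∈ U → g v ≡ g w → f v ≡ f w
        class-kept {v} {w} fw∈U gv≡gw with f v ∈? U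
        ... | yes fv∈U = trans (sym (agree v fv∈U)) (trans gv≡gw (agree w fw∈U))
        ... | no fv∉U  = contradiction (subst (_∈ U) (sym (trans gv≡gw (agree w fw∈U))) fw∈U) (separate v fv∉U)

        separate-∖ : ∀ c v → f v ∉ U ∖ c → g v ∉ U ∖ c
        separate-∖ c v fv∉ gv∈ with f v ∈? U
        ... | yes fv∈U = fv∉ (subst (_∈ U ∖ c) (agree v fv∈U) gv∈)
        ... | no fv∉U  = separate v fv∉U (proj₁ (∈-∖⁻ gv∈))

      freed-∖ : ∀ {U u} c → Freed U u → Freed (U ∖ c) u
      freed-∖ c F = record
        { g = g ; proper = proper ; few = few ; single = single
        ; explored = explored ∘ proj₁ ∘ ∈-∖⁻
        ; agree    = λ v fv∈ → agree v (proj₁ (∈-∖⁻ fv∈))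
        ; separate = separate-∖ c }
        where open Freed F

      module _ {U u} (F : Freed U u) {p} (fp∈U : f p ∈ U) (qp≡qu : q p ≡ q u) where
        open Freed F

        up-face : Face (λ w → w ≡ u ⊎ w ≡ p)
        up-face S S⊆ = q-proper (q u) S λ v v∈S → same v (S⊆ v v∈S)
          where
          same : ∀ v → v ≡ u ⊎ v ≡ p → q v ≡ q u
          same v (inj₁ refl) = refl
          same v (inj₂ refl) = qp≡qu

        u≢p : u ≢ p
        u≢p refl = explored fp∈U

        -- The class of `p` is still intact in `g`, so a singleton `p` could be merged with the
        -- freed `u`, saving a colour.
        ¬p-single : ¬ Singleton f p
        ¬p-single p-single = no-merge proper single
          (λ v gv≡gp → p-single v (class-kept fp∈U gv≡gp)) u≢p up-face

        g′ : Fin n → Fin (suc k)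
        g′ = recolour g p (g u)

        g′-proper : Proper g′
        g′-proper = proper-recolour proper single up-face

        g′-p : g′ p ≡ g u
        g′-p = recolour-at g p (g u)

        g′-off : ∀ {v} → v ≢ p → g′ v ≡ g v
        g′-off = recolour-off g (g u)

        g′-single≢p : ∀ {v} → Singleton g′ v → v ≢ p
        g′-single≢p s refl = u≢p (s u (trans (g′-off u≢p) (sym g′-p)))

        g′-single≢u : ∀ {v} → Singleton g′ v → v ≢ u
        g′-single≢u s refl = u≢p (sym (s p (trans g′-p (sym (g′-off u≢p)))))

        -- Only the class of `p` loses a vertex in passing to `g′`, so new singletons can arise only
        -- there.
        g′-single⇒ : ∀ {v} → Singleton g′ v → f v ≢ f p → Singleton g v
        g′-single⇒ {v} s fv≢fp w gw≡gv with w ≟ p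
        ... | yes refl = contradiction (class-kept fp∈U (sym gw≡gv)) fv≢fp
        ... | no w≢p   = s w (trans (g′-off w≢p) (trans gw≡gv (sym (g′-off (g′-single≢p s)))))

        g′-single-rest : ∀ {v m} → Singleton g′ v → f v ≡ f p → f m ≡ f p → m ≢ p → m ≡ v
        g′-single-rest {v} {m} s fv≡fp fm≡fp m≢p = s m
          (trans (g′-off m≢p) (trans (agree m (in-U fm≡fp))
            (trans fm≡fp (trans (sym fv≡fp) (trans (sym (agree v (in-U fv≡fp))) (sym (g′-off (g′-single≢p s))))))))
          where
          in-U : ∀ {t} → f t ≡ f p → f t ∈ U
          in-U eq = subst (_∈ U) (sym eq) fp∈U

        -- With two vertices left in the class of `p`, the move creates no singleton and destroys
        -- the singleton `u`, contradicting the minimality of `ℓ`.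
        no-third : ∀ {m m′} → f m ≡ f p → m ≢ p → f m′ ≡ f p → m′ ≢ p → m ≡ m′
        no-third {m} {m′} fm m≢p fm′ m′≢p with m ≟ m′ | few
        ... | yes m≡m′ | _ = m≡m′
        ... | no m≢m′  | L , len , L-all = ⊥-elim (no-fewer
              (<-≤-trans (length-∖ (L-all u single)) len) g′ g′-proper
              (L ∖ u , ≤-refl , λ v s → ∈-∖⁺ (L-all v (g′-single⇒ s (fv≢fp s))) (g′-single≢u s)))
          where
          fv≢fp : ∀ {v} → Singleton g′ v → f v ≢ f p
          fv≢fp s fv≡fp = m≢m′ (trans (g′-single-rest s fv≡fp fm m≢p) (sym (g′-single-rest s fv≡fp fm′ m′≢p)))

        -- By `no-third` the class of `p` was a pair, so `m` is left alone when `p` joins `u`.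
        freed-partner : ∀ {m} → f m ≡ f p → m ≢ p → Freed (U ∖ f p) m
        freed-partner {m} fm m≢p with few
        ... | L , len , L-all = record
          { g        = g′
          ; proper   = g′-proper
          -- `m` takes the place of `u`, which now shares its class with `p`, so the bound `ℓ` is
          -- kept.
          ; few      = m ∷ (L ∖ u) , ≤-trans (length-∖ (L-all u single)) len , listed
          ; single   = m-single
          ; explored = λ fm∈ → proj₂ (∈-∖⁻ fm∈) fm
          ; agree    = λ v fv∈ → trans (g′-off (λ v≡p → proj₂ (∈-∖⁻ fv∈) (cong f v≡p))) (agree v (proj₁ (∈-∖⁻ fv∈)))
          ; separate = separate′ }
          where
          listed : ∀ v → Singleton g′ v → v ∈ m ∷ (L ∖ u)
          listed v s with f v ≟ f p
          ... | yes fv≡fp = here (sym (g′-single-rest s fv≡fp fm m≢p))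
          ... | no fv≢fp  = there (∈-∖⁺ (L-all v (g′-single⇒ s fv≢fp)) (g′-single≢u s))

          fm∈U : f m ∈ U
          fm∈U = subst (_∈ U) (sym fm) fp∈U

          m-single : Singleton g′ m
          m-single v eq with v ≟ p
          -- `p` now has the colour of `u`, which is not in `U`, whereas that of `m` is.
          ... | yes refl = contradiction
                  (subst (_∈ U) (sym (trans eq (trans (g′-off m≢p) (agree m fm∈U)))) fm∈U)
                  (separate u explored)
          ... | no v≢p = no-third (trans (class-kept fm∈U (trans eq (g′-off m≢p))) fm) v≢p fm m≢p

          separate′ : ∀ v → f v ∉ U ∖ f p → g′ v ∉ U ∖ f p
          separate′ v fv∉ g′v∈ with v ≟ p
          ... | yes _ = separate u explored (proj₁ (∈-∖⁻ g′v∈))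
          ... | no _  = separate-∖ (f p) v fv∉ g′v∈

      -- An explored vertex need not be freed itself: one that was moved to join `u` is represented
      -- by `u`. Sharing a `q`-class with a freed vertex is all that growing the path requires.
      AllFreed : List (Fin (suc k)) → Set
      AllFreed U = ∀ v → f v ∉ U → ∃ λ u → q v ≡ q u × Freed U u

      Freeable : Set
      Freeable = ∃ λ (g : Fin n → Fin (suc k)) → Proper g × AtMostSingletons g ℓ × Singleton g a × Singleton g z

      -- Each round explores one more `f`-class, so the length of `U` bounds the rounds. The class
      -- of `z` stays unexplored, which keeps `z` a singleton.
      search : ∀ m U → length U ≤ m → f x ∉ U → f z ∈ U → AllFreed U → Freeable
      search m U len fx∉U fz∈U all-freed with f a ∈? U
      ... | no fa∉U with all-freed a fa∉U
      -- `a` is alone in its `q`-class, so the freed vertex representing it is `a` itself.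
      ...   | u , qa≡qu , F with a-single u (sym qa≡qu)
      ...     | refl = g , proper , few , single , λ v gv≡gz → z-single v (class-kept fz∈U gv≡gz)
        where open Freed F
      search m U len fx∉U fz∈U all-freed | yes fa∈U
        with any? (λ w → ¬? (f w ∈? U) ×-dec any? (λ p → (f p ∈? U) ×-dec (q p ≟ q w)))
      -- The explored region is now a union of classes of both `f` and `q`.
      ... | no closed = ⊥-elim (no-swap f q f-proper q-proper U
              (λ v w fw∉U qv≡qw fv∈U → closed (w , fw∉U , v , fv∈U , qv≡qw))
              x-single fx∉U a-single fa∈U xa-face)
      search zero [] _ _ _ _ | yes _ | yes (_ , _ , _ , () , _)
      search (suc m) U len fx∉U fz∈U all-freed | yes fa∈U | yes (w , fw∉U , p , fp∈U , qp≡qw)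
        with all-freed w fw∉U
      ... | u , qw≡qu , F with ¬singleton f (¬p-single F fp∈U (trans qp≡qw qw≡qu))
      ...   | t , ft≡fp , t≢p =
        search m (U ∖ f p) (s≤s⁻¹ (<-≤-trans (length-∖ fp∈U) len)) (fx∉U ∘ proj₁ ∘ ∈-∖⁻)
          (∈-∖⁺ fz∈U fz≢fp) all-freed′
        where
        qp≡qu : q p ≡ q u
        qp≡qu = trans qp≡qw qw≡qu

        fz≢fp : f z ≢ f p
        -- `p` has a classmate `t` under `f`, while `z` has none.
        fz≢fp eq = t≢p (trans (z-single t (trans ft≡fp (sym eq))) (sym (z-single p (sym eq))))

        all-freed′ : AllFreed (U ∖ f p)
        all-freed′ v fv∉ with f v ∈? U | v ≟ p
        ... | no fv∉U | _ with all-freed v fv∉U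
        ...   | u′ , qv≡ , F′ = u′ , qv≡ , freed-∖ (f p) F′
        -- `p` is represented by `u`; the rest of its `f`-class is freed by the move.
        all-freed′ v fv∉ | yes fv∈U | yes refl = u , qp≡qu , freed-∖ (f p) F
        all-freed′ v fv∉ | yes fv∈U | no v≢p with f v ≟ f p
        ... | yes fv≡fp = v , refl , freed-partner F fp∈U qp≡qu fv≡fp v≢p
        ... | no fv≢fp  = contradiction (∈-∖⁺ fv∈U fv≢fp) fv∉

      free-neighbour : Freeable
      free-neighbour = search _ (allFin (suc k) ∖ f x) ≤-refl (λ fx∈ → proj₂ (∈-∖⁻ fx∈) refl)
        (∈-∖⁺ (∈-allFin _) (λ fz≡fx → x≢z (sym (x-single z fz≡fx)))) all-freed
        where
        all-freed : AllFreed (allFin (suc k) ∖ f x)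
        all-freed v fv∉ with f v ≟ f x
        ... | no fv≢fx = contradiction (∈-∖⁺ (∈-allFin _) fv≢fx) fv∉
        -- At the start only the class of `x` is explored, and `f` itself frees `x`.
        ... | yes fv≡fx = x , cong q (x-single v fv≡fx) , record
          { g = f ; proper = f-proper ; few = f-few ; single = x-single
          ; explored = λ fx∈ → proj₂ (∈-∖⁻ fx∈) refl
          ; agree = λ _ _ → refl ; separate = λ _ fv∉U → fv∉U }

    -- Criticality and induction along a path

    -- Criticality colours the other vertices with `k` colours, and `a` gets the fresh colour
    -- `zero`.
    colouring-with-singleton : (∀ U → (∃ λ v → U v ≡ false) → ColourableOn G U k) →
      ∀ a → ∃ λ (q : Fin n → Fin (suc k)) → Proper q × Singleton q a
    colouring-with-singleton critical a = q , q-proper , a-single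
      where
      V∖a : VSet n
      V∖a v = not ⌊ v ≟ a ⌋

      a∉ : V∖a a ≡ false
      a∉ with a ≟ a
      ... | yes _  = refl
      ... | no a≢a = contradiction refl a≢a

      h : Fin n → Fin k
      h = proj₁ (critical V∖a (a , a∉))

      q : Fin n → Fin (suc k)
      q = recolour (suc ∘ h) a zero

      q-zero : ∀ v → q v ≡ zero → v ≡ a
      q-zero v eq with v ≟ a
      ... | yes v≡a = v≡a
      q-zero v () | no _

      q-suc : ∀ {i} v → q v ≡ suc i → v ∈ᵥ V∖a × h v ≡ i
      q-suc v eq with v ≟ a
      q-suc v () | yes _
      ... | no v≢a = refl , suc-injective eq

      q-proper : Proper q
      q-proper zero S S⊆    = face-vertex a S (λ v v∈S → q-zero v (S⊆ v v∈S))
      q-proper (suc i) S S⊆ = face-class (proj₂ (critical V∖a (a , a∉)) i) S (λ v v∈S → q-suc v (S⊆ v v∈S))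

      a-single : Singleton q a
      a-single v eq = q-zero v (trans eq (recolour-at (suc ∘ h) a zero))

    module _ (critical : ∀ U → (∃ λ v → U v ≡ false) → ColourableOn G U k) where

      -- Each step replaces `x` by the next vertex `a` of the path and changes the colouring, but
      -- keeps `z` a singleton and the bound `ℓ`, so minimality remains available.
      no-path-between-singletons : ∀ ℓ →
        (∀ {ℓ′} → ℓ′ < ℓ → (g : Fin n → Fin (suc k)) → Proper g → ¬ AtMostSingletons g ℓ′) →
        ∀ {x z} → CReach G x z → x ≢ z → (f : Fin n → Fin (suc k)) → Proper f → AtMostSingletons f ℓ →
        Singleton f x → ¬ Singleton f z
      no-path-between-singletons ℓ no-fewer here x≢z _ _ _ _ _ = x≢z refl
      no-path-between-singletons ℓ no-fewer {x} {z} (there {v = a} adj r) x≢z f f-proper f-few x-single z-single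
        with a ≟ z
      ... | yes refl = no-merge f-proper x-single z-single x≢z (face-CAdj adj)
      ... | no a≢z with colouring-with-singleton critical a
      ...   | q , q-proper , a-single
              with free-neighbour f q f-proper q-proper x-single z-single x≢z a-single (face-CAdj adj) ℓ f-few no-fewer
      ...     | g , g-proper , g-few , a-single′ , z-single′ =
                no-path-between-singletons ℓ no-fewer r a≢z g g-proper g-few a-single′ z-single′

      -- In strong induction on `ℓ`, the induction hypothesis is exactly the minimality of `ℓ`.
      no-colouring : (∀ u v → CReach G u v) → n < suc k + k →
        ∀ ℓ (f : Fin n → Fin (suc k)) → Proper f → ¬ AtMostSingletons f ℓ
      no-colouring connected n< = <-rec _ λ ℓ no-fewer f f-proper f-few →
        let x , z , x≢z , x-single , z-single = two-singletons f f-proper n<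
        in no-path-between-singletons ℓ no-fewer (connected x z) x≢z f f-proper f-few x-single z-single

theorem1 : (k n : ℕ) → 1 ≤ k → (G : Digraph n) → VertexCritical G k →
    n ≤ 2 * k ∸ 2 → ComplementDisconnected G
theorem1 (suc k) n _ G (((f , f-acyclic) , ¬colourable) , critical) n≤
  with any? (λ u → any? (λ v → ¬? (CReach? G u v)))
... | yes disconnected = disconnected
-- Any bound on the singletons will do; the list of all `n` vertices gives one.
... | no ¬disconnected = ⊥-elim (no-colouring G ¬colourable critical connected n< n f f-proper
        (allFin n , ≤-reflexive (length-allFin n) , λ v _ → ∈-allFin v))
  where
  connected : ∀ u v → CReach G u v
  connected u v = decidable-stable (CReach? G u v) (λ ¬r → ¬disconnected (u , v , ¬r))

  f-proper : Proper G f
  f-proper i S S⊆ = face-class G (f-acyclic i) S (λ v v∈S → refl , S⊆ v v∈S)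

  -- `2 * suc k ∸ 2` equals `k + k`, one less than two vertices for each of `suc k` classes with a
  -- single exception.
  n< : n < suc k + k
  n< = s≤s (≤-trans n≤ (≤-reflexive (trans (cong (_∸ 1) (+-suc k (k + 0))) (cong (k +_) (+-identityʳ k)))))
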